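{- Let $W\colon \mathbb{N}\to\{0,1\}$ be a binary Sturmian word and let $n$ be a positive integer. Then \[ \sum_{\vec w \in F_n(W)} h(\vec w) \equiv n \pmod 2, \] where for $\vec w=(w_1,\dots,w_n)\in\{0,1\}^n$, $h(\vec w)$ denotes the number of indices $j$ with $w_j=1$.
   Context: Here $\mathbb{N}=\{0,1,2,\dots\}$. A binary word is a map $W\colon\mathbb{N}\to\{0,1\}$. For $n\ge1$, the set of factors of $W$ of length $n$ is $F_n(W):=\{(W(i),W(i+1),\dots,W(i+n-1))\colon i\ge 0\}\subseteq\{0,1\}^n$. The word $W$ is Sturmian if $|F_n(W)|=n+1$ for every $n\ge 1$. The quantity $h(\vec w)$ (the height, or Hamming weight) is the number of components of $\vec w$ equal to $1$. -}

module Defs where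

open import Data.Nat using (ℕ; zero; suc; _+_)
open import Data.Bool using (Bool; true; false)
open import Data.Fin using (Fin; toℕ)
open import Data.Vec using (Vec; tabulate; count)
open import Data.List using (List; length)
open import Data.List.Membership.Propositional using (_∈_)
open import Data.List.Relation.Unary.Unique.Propositional using (Unique)
open import Data.Product using (Σ; ∃; _×_)
open import Relation.Binary.PropositionalEquality using (_≡_)
open import Relation.Nullary using (does)
open import Data.Bool.Properties using () renaming (_≟_ to _≟ᵇ_)
open import Function.Bundles using (_⇔_)

-- A binary word W : ℕ → {0,1}; we encode {0,1} as Bool (false = 0, true = 1).
Word : Set
Word = ℕ → Bool

factorAt : Word → (n i : ℕ) → Vec Bool n
factorAt W n i = tabulate (λ j → W (i + toℕ j))

IsFactor : Word → (n : ℕ) → Vec Bool n → Set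
IsFactor W n v = ∃ λ i → factorAt W n i ≡ v

Enumerates : Word → (n : ℕ) → List (Vec Bool n) → Set
Enumerates W n L = Unique L × (∀ v → (v ∈ L) ⇔ IsFactor W n v)

Sturmian : Word → Set
Sturmian W = ∀ n → 1 Data.Nat.≤ n →
  Σ (List (Vec Bool n)) λ L → Enumerates W n L × length L ≡ suc n

h : ∀ {n} → Vec Bool n → ℕ
h = count (λ b → b ≟ᵇ true)

{-# OPTIONS --safe #-}
module Submission where

-- Let R and L be the unique right and left special factors of length n, S(n) the total height.
-- Every factor of length n extends to the right uniquely, except R, which extends both ways, so
-- S(n+1) = S(n) + h(R) + #{w ∈ F(n+1) ending in 1}. Extending one letter to the left at a time,
-- that number is 1 + h(L), because the left special factors are prefixes of one another.
-- Balance, applied to R0, 1L and to R1, 0L, gives h(R) = h(L), so S(n+1) ≡ S(n) + 1.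
-- Balance itself: a shortest violation has the form 1w1, 0w0 with w a palindrome, and this
-- would confine W to a cycle of the Rauzy graph that misses the right special factor.

open import Defs
open import Data.Bool using (Bool; true; false; not; if_then_else_)
open import Data.Bool.Properties using (¬-not; not-¬) renaming (_≟_ to _≟ᵇ_)
open import Data.Empty using (⊥; ⊥-elim)
open import Data.Fin using (Fin; toℕ; fromℕ<) renaming (zero to fzero; suc to fsuc; _<_ to _<ᶠ_)
open import Data.Fin.Properties using (pigeonhole; toℕ<n; fromℕ<-injective)
open import Data.List using (List; []; _∷_; length; lookup; map)
import Data.List.Membership.DecPropositional as DecMembership
open import Data.List.Membership.Propositional using (_∈_)
open import Data.List.Membership.Propositional.Properties using (∈-lookup)
import Data.List.Relation.Unary.All as All
open import Data.List.Relation.Unary.AllPairs using ([]; _∷_)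
open import Data.List.Relation.Unary.Any using (here; there; index)
open import Data.List.Relation.Unary.Any.Properties using (lookup-index)
open import Data.List.Relation.Unary.Unique.Propositional using (Unique)
open import Data.Nat
open import Data.Nat.DivMod using ([m+kn]%n≡m%n; %-distribˡ-+)
open import Data.Nat.Induction using (<-rec)
open import Data.Nat.ListAction using (sum)
open import Data.Nat.Properties
open import Data.Nat.Tactic.RingSolver using (solve-∀)
open import Data.Product using (∃; ∃₂; _×_; _,_; proj₁; proj₂)
open import Data.Sum using (_⊎_; inj₁; inj₂)
open import Data.Unit using (⊤; tt)
open import Data.Vec using (Vec; []; _∷_; _∷ʳ_; reverse)
open import Data.Vec.Properties
  using (reverse-∷; tabulate-cong; ∷-injectiveˡ; ∷-injectiveʳ; ∷ʳ-injectiveˡ; ≡-dec)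
open import Function.Bundles using (module Equivalence)
open import Relation.Binary.PropositionalEquality
open import Relation.Nullary using (Dec; yes; no; does; ¬_)
open import Relation.Nullary.Decidable using (map′)
open ≡-Reasoning

-- Sums over the cube of binary vectors and indicator functions.

bit : Bool → ℕ
bit b = if b then 1 else 0

-- The sum ranges over the whole cube, so that a set of factors enters as a 0/1 weight and counting
-- identities can be checked pointwise.
Sum : ∀ n → (Vec Bool n → ℕ) → ℕ
Sum zero    f = f []
Sum (suc n) f = Sum n (λ v → f (false ∷ v)) + Sum n (λ v → f (true ∷ v))

Sum-cong : ∀ n {f g : Vec Bool n → ℕ} → (∀ v → f v ≡ g v) → Sum n f ≡ Sum n g
Sum-cong zero    p = p []
Sum-cong (suc n) p = cong₂ _+_ (Sum-cong n (λ v → p (false ∷ v))) (Sum-cong n (λ v → p (true ∷ v)))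

interchange : ∀ a b c d → (a + b) + (c + d) ≡ (a + c) + (b + d)
interchange = solve-∀

Sum-+ : ∀ n (f g : Vec Bool n → ℕ) → Sum n (λ v → f v + g v) ≡ Sum n f + Sum n g
Sum-+ zero    f g = refl
Sum-+ (suc n) f g = trans (cong₂ _+_ (Sum-+ n _ _) (Sum-+ n _ _))
  (interchange (Sum n (λ v → f (false ∷ v))) _ (Sum n (λ v → f (true ∷ v))) _)

-- `Sum` peels off the first letter by definition; extending factors to the right needs the last
-- one.
Sum-snoc : ∀ n (f : Vec Bool (suc n) → ℕ) →
  Sum (suc n) f ≡ Sum n (λ v → f (v ∷ʳ false) + f (v ∷ʳ true))
Sum-snoc zero    f = refl
Sum-snoc (suc n) f =
  cong₂ _+_ (Sum-snoc n (λ v → f (false ∷ v))) (Sum-snoc n (λ v → f (true ∷ v)))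

Sum-reverse : ∀ n (f : Vec Bool n → ℕ) → Sum n (λ v → f (reverse v)) ≡ Sum n f
Sum-reverse zero    f = refl
Sum-reverse (suc n) f = begin
  Sum n (λ v → f (reverse (false ∷ v))) + Sum n (λ v → f (reverse (true ∷ v)))
    ≡⟨ cong₂ _+_ (Sum-cong n (λ v → cong f (reverse-∷ false v)))
                 (Sum-cong n (λ v → cong f (reverse-∷ true v))) ⟩
  Sum n (λ v → f (reverse v ∷ʳ false)) + Sum n (λ v → f (reverse v ∷ʳ true))
    ≡⟨ cong₂ _+_ (Sum-reverse n _) (Sum-reverse n _) ⟩
  Sum n (λ v → f (v ∷ʳ false)) + Sum n (λ v → f (v ∷ʳ true))
    ≡⟨ Sum-+ n _ _ ⟨
  Sum n (λ v → f (v ∷ʳ false) + f (v ∷ʳ true))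
    ≡⟨ Sum-snoc n f ⟨
  Sum (suc n) f ∎

Sum-zero : ∀ n → Sum n (λ _ → 0) ≡ 0
Sum-zero zero    = refl
Sum-zero (suc n) = cong₂ _+_ (Sum-zero n) (Sum-zero n)

Sum≡0⇒≗0 : ∀ n (f : Vec Bool n → ℕ) → Sum n f ≡ 0 → ∀ v → f v ≡ 0
Sum≡0⇒≗0 zero    f eq []          = eq
Sum≡0⇒≗0 (suc n) f eq (false ∷ v) = Sum≡0⇒≗0 n _ (m+n≡0⇒m≡0 _ eq) v
Sum≡0⇒≗0 (suc n) f eq (true ∷ v)  = Sum≡0⇒≗0 n _ (m+n≡0⇒n≡0 (Sum n (λ v → f (false ∷ v))) eq) v

δ : ∀ {n} → Vec Bool n → Vec Bool n → ℕ
δ []          []          = 1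
δ (false ∷ r) (false ∷ v) = δ r v
δ (true  ∷ r) (true  ∷ v) = δ r v
δ (false ∷ r) (true  ∷ v) = 0
δ (true  ∷ r) (false ∷ v) = 0

δ-refl : ∀ {n} (r : Vec Bool n) → δ r r ≡ 1
δ-refl []          = refl
δ-refl (false ∷ r) = δ-refl r
δ-refl (true ∷ r)  = δ-refl r

δ-≢ : ∀ {n} (r v : Vec Bool n) → v ≢ r → δ r v ≡ 0
δ-≢ []          []          ne = ⊥-elim (ne refl)
δ-≢ (false ∷ r) (false ∷ v) ne = δ-≢ r v (λ e → ne (cong (false ∷_) e))
δ-≢ (true  ∷ r) (true  ∷ v) ne = δ-≢ r v (λ e → ne (cong (true ∷_) e))
δ-≢ (false ∷ r) (true  ∷ v) ne = refl
δ-≢ (true  ∷ r) (false ∷ v) ne = refl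

δ≡1⇒≡ : ∀ {n} (r v : Vec Bool n) → δ r v ≡ 1 → v ≡ r
δ≡1⇒≡ []          []          eq = refl
δ≡1⇒≡ (false ∷ r) (false ∷ v) eq = cong (false ∷_) (δ≡1⇒≡ r v eq)
δ≡1⇒≡ (true  ∷ r) (true  ∷ v) eq = cong (true ∷_) (δ≡1⇒≡ r v eq)
δ≡1⇒≡ (false ∷ r) (true  ∷ v) ()
δ≡1⇒≡ (true  ∷ r) (false ∷ v) ()

Sum-δ : ∀ n (r : Vec Bool n) (g : Vec Bool n → ℕ) → Sum n (λ v → δ r v * g v) ≡ g r
Sum-δ zero    []          g = *-identityˡ (g [])
Sum-δ (suc n) (false ∷ r) g =
  trans (cong₂ _+_ (Sum-δ n r (λ v → g (false ∷ v))) (Sum-zero n)) (+-identityʳ _)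
Sum-δ (suc n) (true ∷ r)  g = cong₂ _+_ (Sum-zero n) (Sum-δ n r (λ v → g (true ∷ v)))

Sum-δ-head : ∀ n b (r : Vec Bool n) → Sum n (λ v → δ (b ∷ r) (true ∷ v)) ≡ bit b
Sum-δ-head n false r = Sum-zero n
Sum-δ-head n true  r =
  trans (Sum-cong n (λ v → sym (*-identityʳ (δ r v)))) (Sum-δ n r (λ _ → 1))

m+n≡1 : ∀ m n → m + n ≡ 1 → (m ≡ 1 × n ≡ 0) ⊎ (m ≡ 0 × n ≡ 1)
m+n≡1 zero    n eq = inj₂ (refl , eq)
m+n≡1 (suc m) n eq = inj₁ (cong suc (m+n≡0⇒m≡0 m (suc-injective eq)) , m+n≡0⇒n≡0 m (suc-injective eq))

-- A total of 1 in natural numbers sits at a single point, found by descending into the half of the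
-- cube that carries it. This turns a count of special factors into the special factor itself.
Sum≡1⇒≗δ : ∀ n (f : Vec Bool n → ℕ) → Sum n f ≡ 1 → ∃ λ r → ∀ v → f v ≡ δ r v
Sum≡1⇒≗δ zero    f eq = [] , λ { [] → eq }
Sum≡1⇒≗δ (suc n) f eq with m+n≡1 (Sum n (λ v → f (false ∷ v))) _ eq
... | inj₁ (eq₁ , eq₀) = let r , p = Sum≡1⇒≗δ n _ eq₁ in
  false ∷ r , λ { (false ∷ v) → p v ; (true ∷ v) → Sum≡0⇒≗0 n _ eq₀ v }
... | inj₂ (eq₀ , eq₁) = let r , p = Sum≡1⇒≗δ n _ eq₁ in
  true ∷ r , λ { (true ∷ v) → p v ; (false ∷ v) → Sum≡0⇒≗0 n _ eq₀ v }

ind : ∀ {P : Set} → Dec P → ℕ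
ind P? = bit (does P?)

ind-cong : ∀ {P Q : Set} (P? : Dec P) (Q? : Dec Q) → (P → Q) → (Q → P) → ind P? ≡ ind Q?
ind-cong (yes _) (yes _) f g = refl
ind-cong (no _)  (no _)  f g = refl
ind-cong (yes p) (no ¬q) f g = ⊥-elim (¬q (f p))
ind-cong (no ¬p) (yes q) f g = ⊥-elim (¬p (g q))

ind-yes : ∀ {P : Set} (P? : Dec P) → P → ind P? ≡ 1
ind-yes (yes _) p = refl
ind-yes (no ¬p) p = ⊥-elim (¬p p)

ind-no : ∀ {P : Set} (P? : Dec P) → ¬ P → ind P? ≡ 0
ind-no (yes p) ¬p = ⊥-elim (¬p p)
ind-no (no _)  ¬p = refl

h-∷ : ∀ {n} b (v : Vec Bool n) → h (b ∷ v) ≡ bit b + h v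
h-∷ false v = refl
h-∷ true  v = refl

-- Right special words of an abstract language with `suc n` words of each length `n`.

module RightSpecial
  (F      : ∀ {n} → Vec Bool n → Set)
  (F?     : ∀ {n} (v : Vec Bool n) → Dec (F v))
  (total  : ∀ n → Sum n (λ v → ind (F? v)) ≡ suc n)
  (suffix : ∀ {n} b (v : Vec Bool n) → F (b ∷ v) → F v)
  (prefix : ∀ {n} b (v : Vec Bool n) → F (v ∷ʳ b) → F v)
  (extend : ∀ {n} (v : Vec Bool n) → F v → ∃ λ b → F (v ∷ʳ b))
  where

  φ : ∀ {n} → Vec Bool n → ℕ
  φ v = ind (F? v)

  -- The indicator of right special words.
  excess : ∀ {n} → Vec Bool n → ℕ
  excess v = φ (v ∷ʳ false) * φ (v ∷ʳ true)

  Special : ∀ {n} → Vec Bool n → Set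
  Special v = F (v ∷ʳ false) × F (v ∷ʳ true)

  -- Off the language every term vanishes by `prefix`; on it, `extend` excludes a word without
  -- successor, so the surplus is 1 exactly when both letters can follow.
  φ-split : ∀ {n} (v : Vec Bool n) → φ (v ∷ʳ false) + φ (v ∷ʳ true) ≡ φ v + excess v
  φ-split v with F? v | F? (v ∷ʳ false) | F? (v ∷ʳ true)
  ... | yes _ | yes _  | yes _  = refl
  ... | yes _ | yes _  | no _   = refl
  ... | yes _ | no _   | yes _  = refl
  ... | yes p | no ¬p₀ | no ¬p₁ with extend v p
  ...   | false , q = ⊥-elim (¬p₀ q)
  ...   | true  , q = ⊥-elim (¬p₁ q)
  φ-split v | no ¬p | yes q | _     = ⊥-elim (¬p (prefix false v q))
  φ-split v | no ¬p | no _  | yes q = ⊥-elim (¬p (prefix true v q))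
  φ-split v | no ¬p | no _  | no _  = refl

  -- The complexity grows by one from length `n` to `suc n`, and by `φ-split` this growth is the
  -- number of special words.
  Sum-excess : ∀ n → Sum n excess ≡ 1
  Sum-excess n = +-cancelˡ-≡ (suc n) _ _ (begin
    suc n + Sum n excess                                 ≡⟨ cong (_+ Sum n excess) (total n) ⟨
    Sum n φ + Sum n excess                               ≡⟨ Sum-+ n φ excess ⟨
    Sum n (λ v → φ v + excess v)                         ≡⟨ Sum-cong n φ-split ⟨
    Sum n (λ v → φ (v ∷ʳ false) + φ (v ∷ʳ true))         ≡⟨ Sum-snoc n φ ⟨
    Sum (suc n) φ                                        ≡⟨ total (suc n) ⟩
    suc (suc n)                                          ≡⟨ +-comm 1 (suc n) ⟩
    suc n + 1                                            ∎)

  abstract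
    R : ∀ n → Vec Bool n
    R n = proj₁ (Sum≡1⇒≗δ n excess (Sum-excess n))

    excess-δ : ∀ {n} (v : Vec Bool n) → excess v ≡ δ (R n) v
    excess-δ {n} = proj₂ (Sum≡1⇒≗δ n excess (Sum-excess n))

  R-special : ∀ n → Special (R n)
  R-special n = go (trans (excess-δ (R n)) (δ-refl (R n)))
    where
    go : excess (R n) ≡ 1 → Special (R n)
    go eq with F? (R n ∷ʳ false) | F? (R n ∷ʳ true)
    go eq | yes p | yes q = p , q
    go () | yes _ | no _
    go () | no _  | _

  special⇒≡R : ∀ {n} (v : Vec Bool n) → Special v → v ≡ R n
  special⇒≡R {n} v (p , q) = δ≡1⇒≡ (R n) v
    (trans (sym (excess-δ v)) (cong₂ _*_ (ind-yes (F? _) p) (ind-yes (F? _) q)))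

  -- Deleting the first letter keeps a word special, and the special word of each length is unique.
  R-suc : ∀ n → ∃ λ b → R (suc n) ≡ b ∷ R n
  R-suc n with R (suc n) | R-special (suc n)
  ... | b ∷ v | p , q = b , cong (b ∷_) (special⇒≡R v (suffix b _ p , suffix b _ q))

  -- Lengthening to the right adds one word beginning with 1 exactly when `R (suc n)` begins with 1.
  -- That first letter is also what `R (suc n)` adds to the height of `R n`. For the base case, the
  -- empty word is special, so the letter 1 occurs.
  starts-with-1 : ∀ n → Sum n (λ v → φ (true ∷ v)) ≡ suc (h (R n))
  starts-with-1 zero with R 0 | R-special 0
  ... | [] | _ , q = ind-yes (F? _) q
  starts-with-1 (suc n) with R-suc n
  ... | b , eq = begin
    Sum (suc n) (λ v → φ (true ∷ v))
      ≡⟨ Sum-snoc n (λ v → φ (true ∷ v)) ⟩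
    Sum n (λ v → φ (true ∷ (v ∷ʳ false)) + φ (true ∷ (v ∷ʳ true)))
      ≡⟨ Sum-cong n (λ v → φ-split (true ∷ v)) ⟩
    Sum n (λ v → φ (true ∷ v) + excess (true ∷ v))
      ≡⟨ Sum-+ n _ _ ⟩
    Sum n (λ v → φ (true ∷ v)) + Sum n (λ v → excess (true ∷ v))
      ≡⟨ cong₂ _+_ (starts-with-1 n) (Sum-cong n (λ v →
           trans (excess-δ (true ∷ v)) (cong (λ r → δ r (true ∷ v)) eq))) ⟩
    suc (h (R n)) + Sum n (λ v → δ (b ∷ R n) (true ∷ v))
      ≡⟨ cong (suc (h (R n)) +_) (Sum-δ-head n b (R n)) ⟩
    suc (h (R n)) + bit b
      ≡⟨ cong suc (trans (+-comm (h (R n)) (bit b)) (sym (h-∷ b (R n)))) ⟩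
    suc (h (b ∷ R n))
      ≡⟨ cong (λ r → suc (h r)) eq ⟨
    suc (h (R (suc n))) ∎

-- Duplicate-free lists as indicator weights, and the pigeonhole principle.

_∈?_ : ∀ {n} (v : Vec Bool n) (L : List (Vec Bool n)) → Dec (v ∈ L)
_∈?_ = DecMembership._∈?_ (≡-dec _≟ᵇ_)

∈-δ : ∀ {n} (v x : Vec Bool n) L → All.All (x ≢_) L → ind (v ∈? (x ∷ L)) ≡ δ x v + ind (v ∈? L)
∈-δ v x L x∉L = by-cases (≡-dec _≟ᵇ_ v x)
  where
  by-cases : Dec (v ≡ x) → ind (v ∈? (x ∷ L)) ≡ δ x v + ind (v ∈? L)
  by-cases (yes refl) = trans (ind-yes (v ∈? (v ∷ L)) (here refl))
    (sym (cong₂ _+_ (δ-refl v) (ind-no (v ∈? L) (λ v∈L → All.lookup x∉L v∈L refl))))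
  by-cases (no v≢x) = trans
    (ind-cong (v ∈? (x ∷ L)) (v ∈? L) (λ { (here e) → ⊥-elim (v≢x e) ; (there p) → p }) there)
    (cong (_+ ind (v ∈? L)) (sym (δ-≢ x v v≢x)))

-- Uniqueness makes the membership indicator the sum of the `δ` of the entries. This links the
-- enumerations in the theorem to sums over the cube.
Sum-∈ : ∀ n (L : List (Vec Bool n)) → Unique L → ∀ g → Sum n (λ v → ind (v ∈? L) * g v) ≡ sum (map g L)
Sum-∈ n []      u g = Sum-zero n
Sum-∈ n (x ∷ L) (x∉L ∷ u) g = begin
  Sum n (λ v → ind (v ∈? (x ∷ L)) * g v)
    ≡⟨ Sum-cong n (λ v → trans (cong (_* g v) (∈-δ v x L x∉L)) (*-distribʳ-+ (g v) (δ x v) _)) ⟩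
  Sum n (λ v → δ x v * g v + ind (v ∈? L) * g v)
    ≡⟨ Sum-+ n _ _ ⟩
  Sum n (λ v → δ x v * g v) + Sum n (λ v → ind (v ∈? L) * g v)
    ≡⟨ cong₂ _+_ (Sum-δ n x g) (Sum-∈ n L u g) ⟩
  sum (map g (x ∷ L)) ∎

lookup-distinct : ∀ {A : Set} {L : List A} → Unique L → ∀ {i j} → i <ᶠ j → lookup L i ≢ lookup L j
lookup-distinct (x∉L ∷ u) {fzero}  {fsuc j} i<j       eq = All.lookup x∉L (∈-lookup j) eq
lookup-distinct (x∉L ∷ u) {fsuc i} {fsuc j} (s≤s i<j) eq = lookup-distinct u i<j eq

repetition : ∀ {A : Set} (L : List A) (f : ℕ → A) → (∀ t → f t ∈ L) →
  ∃₂ λ s t → s < t × t ≤ length L × f s ≡ f t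
repetition L f f∈L with pigeonhole (n<1+n (length L)) (λ t → index (f∈L (toℕ t)))
... | s , t , s<t , eq = toℕ s , toℕ t , s<t , ≤-pred (toℕ<n t) ,
  trans (lookup-index (f∈L (toℕ s))) (trans (cong (lookup L) eq) (sym (lookup-index (f∈L (toℕ t)))))

-- Factors of an arbitrary word.

module Factors (W : Word) where

  block : ∀ n → ℕ → Vec Bool n
  block = factorAt W

  block-∷ : ∀ n i → block (suc n) i ≡ W i ∷ block n (suc i)
  block-∷ n i = cong₂ _∷_ (cong W (+-identityʳ i)) (tabulate-cong (λ j → cong W (+-suc i (toℕ j))))

  block-∷ʳ : ∀ n i → block (suc n) i ≡ block n i ∷ʳ W (i + n)
  block-∷ʳ zero    i = refl
  block-∷ʳ (suc n) i = begin
    block (suc (suc n)) i                        ≡⟨ block-∷ (suc n) i ⟩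
    W i ∷ block (suc n) (suc i)                  ≡⟨ cong (W i ∷_) (block-∷ʳ n (suc i)) ⟩
    W i ∷ (block n (suc i) ∷ʳ W (suc i + n))     ≡⟨ cong₂ (λ v k → v ∷ʳ W k) (block-∷ n i) (+-suc i n) ⟨
    block (suc n) i ∷ʳ W (i + suc n)             ∎

  block-ext : ∀ n i j → (∀ k → k < n → W (i + k) ≡ W (j + k)) → block n i ≡ block n j
  block-ext n i j p = tabulate-cong (λ k → p (toℕ k) (toℕ<n k))

  block-at : ∀ n i j → block n i ≡ block n j → ∀ k → k < n → W (i + k) ≡ W (j + k)
  block-at (suc n) i j eq zero    _         = ∷-injectiveˡ eq
  block-at (suc n) i j eq (suc k) (s≤s k<n) = begin
    W (i + suc k)   ≡⟨ cong W (+-suc i k) ⟩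
    W (suc i + k)   ≡⟨ block-at n (suc i) (suc j)
                         (∷-injectiveʳ (trans (sym (block-∷ n i)) (trans eq (block-∷ n j)))) k k<n ⟩
    W (suc j + k)   ≡⟨ cong W (+-suc j k) ⟨
    W (j + suc k)   ∎

  block-suc : ∀ n i j → block n i ≡ block n j → W (i + n) ≡ W (j + n) → block n (suc i) ≡ block n (suc j)
  block-suc n i j eq eq′ = ∷-injectiveʳ (begin
    W i ∷ block n (suc i)      ≡⟨ block-∷ n i ⟨
    block (suc n) i            ≡⟨ block-∷ʳ n i ⟩
    block n i ∷ʳ W (i + n)     ≡⟨ cong₂ _∷ʳ_ eq eq′ ⟩
    block n j ∷ʳ W (j + n)     ≡⟨ block-∷ʳ n j ⟨
    block (suc n) j            ≡⟨ block-∷ n j ⟩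
    W j ∷ block n (suc j)      ∎)

  F : ∀ {n} → Vec Bool n → Set
  F {n} = IsFactor W n

  F-suffix : ∀ {n} b (v : Vec Bool n) → F (b ∷ v) → F v
  F-suffix {n} b v (i , eq) = suc i , ∷-injectiveʳ (trans (sym (block-∷ n i)) eq)

  F-prefix : ∀ {n} b (v : Vec Bool n) → F (v ∷ʳ b) → F v
  F-prefix {n} b v (i , eq) = i , ∷ʳ-injectiveˡ _ v (trans (sym (block-∷ʳ n i)) eq)

  F-extend : ∀ {n} (v : Vec Bool n) → F v → ∃ λ b → F (v ∷ʳ b)
  F-extend {n} v (i , eq) = W (i + n) , i , trans (block-∷ʳ n i) (cong (_∷ʳ W (i + n)) eq)

-- Counting, aperiodicity and recurrence for Sturmian words.

module SturmianWord (W : Word) (sturmian : Sturmian W) where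
  open Factors W public

  abstract
    -- Positions cannot be searched exhaustively; the finite list supplied by `sturmian` makes being
    -- a factor decidable.
    F? : ∀ {n} (v : Vec Bool n) → Dec (F v)
    F? {zero}  [] = yes (0 , refl)
    F? {suc n} v  with sturmian (suc n) (s≤s z≤n)
    ... | L , (_ , ∈⇔F) , _ = map′ (Equivalence.to (∈⇔F v)) (Equivalence.from (∈⇔F v)) (v ∈? L)

  Sum-enumerated : ∀ n L → Enumerates W n L → ∀ g → Sum n (λ v → ind (F? v) * g v) ≡ sum (map g L)
  Sum-enumerated n L (u , ∈⇔F) g = trans
    (Sum-cong n (λ v → cong (_* g v)
      (ind-cong (F? v) (v ∈? L) (Equivalence.from (∈⇔F v)) (Equivalence.to (∈⇔F v)))))
    (Sum-∈ n L u g)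

  sum-1 : ∀ {A : Set} (L : List A) → sum (map (λ _ → 1) L) ≡ length L
  sum-1 []      = refl
  sum-1 (_ ∷ L) = cong suc (sum-1 L)

  total : ∀ n → Sum n (λ v → ind (F? v)) ≡ suc n
  total zero    = ind-yes (F? []) (0 , refl)
  total (suc n) = let L , L-enum , len = sturmian (suc n) (s≤s z≤n) in begin
    Sum (suc n) (λ v → ind (F? v))       ≡⟨ Sum-cong (suc n) (λ v → *-identityʳ (ind (F? v))) ⟨
    Sum (suc n) (λ v → ind (F? v) * 1)   ≡⟨ Sum-enumerated (suc n) L L-enum (λ _ → 1) ⟩
    sum (map (λ _ → 1) L)                ≡⟨ sum-1 L ⟩
    length L                             ≡⟨ len ⟩
    suc (suc n)                          ∎

  -- A purely periodic tail from X on leaves at most X + p factors of length X + p.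
  aperiodic : ∀ X p → 1 ≤ p → (∀ t → W (X + t) ≡ W (X + (p + t))) → ⊥
  aperiodic X p 1≤p per with sturmian (X + p) (≤-trans 1≤p (m≤n+m p X))
  ... | L , (u , ∈⇔F) , len = collide
    where
    K = X + p
    early : ∀ i → ∃ λ i′ → i′ < K × (∀ k → W (i′ + k) ≡ W (i + k))
    early = <-rec _ step
      where
      step : ∀ i → (∀ {j} → j < i → ∃ λ i′ → i′ < K × (∀ k → W (i′ + k) ≡ W (j + k))) →
        ∃ λ i′ → i′ < K × (∀ k → W (i′ + k) ≡ W (i + k))
      step i rec with i <? K
      ... | yes i<K = i , i<K , λ _ → refl
      ... | no  i≮K with m≤n⇒∃[o]m+o≡n (≮⇒≥ i≮K)
      ...   | t , refl with rec {X + t} (+-monoˡ-< t (m<m+n X 1≤p))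
      ...     | i′ , i′<K , same = i′ , i′<K , λ k → begin
        W (i′ + k)              ≡⟨ same k ⟩
        W ((X + t) + k)         ≡⟨ cong W (+-assoc X t k) ⟩
        W (X + (t + k))         ≡⟨ per (t + k) ⟩
        W (X + (p + (t + k)))   ≡⟨ cong W (rearrange X p t k) ⟩
        W (((X + p) + t) + k)   ∎
        where
        rearrange : ∀ a b c d → a + (b + (c + d)) ≡ ((a + b) + c) + d
        rearrange = solve-∀
    position : ∀ (a : Fin (length L)) → ∃ λ i → i < K × block K i ≡ lookup L a
    position a with Equivalence.to (∈⇔F (lookup L a)) (∈-lookup a)
    ... | i , eq with early i
    ...   | i′ , i′<K , same = i′ , i′<K , trans (block-ext K i′ i (λ k _ → same k)) eq
    collide : ⊥
    collide with pigeonhole (subst (K <_) (sym len) (n<1+n K)) (λ a → fromℕ< (proj₁ (proj₂ (position a))))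
    ... | a , b , a<b , eq = lookup-distinct u a<b (begin
      lookup L a                      ≡⟨ proj₂ (proj₂ (position a)) ⟨
      block K (proj₁ (position a))    ≡⟨ cong (block K) (fromℕ<-injective _ _ _ _ eq) ⟩
      block K (proj₁ (position b))    ≡⟨ proj₂ (proj₂ (position b)) ⟩
      lookup L b                      ∎)

  -- `Good` marks blocks that determine their next letter. Once a block returns after `p` steps
  -- through good blocks only, the same letters follow forever, so `W` has period `p` from `x + n`
  -- on, against `aperiodic`.
  no-deterministic-cycle : ∀ n (Good : Vec Bool n → Set) x p → 1 ≤ p →
    block n x ≡ block n (x + p) →
    (∀ t → t < p → Good (block n (x + t))) →
    (∀ s t → Good (block n (x + s)) → block n (x + s) ≡ block n (x + t) →
      W (x + s + n) ≡ W (x + t + n)) →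
    ⊥
  no-deterministic-cycle n Good x p 1≤p closes good det = aperiodic (x + n) p 1≤p periodic
    where
    Eq : ℕ → Set
    Eq t = block n (x + t) ≡ block n (x + (p + t))

    invariant : ∀ t → Eq t × (∀ s → s < p + t → Good (block n (x + s)))
    invariant zero =
      trans (cong (block n) (+-identityʳ x))
        (trans closes (cong (λ k → block n (x + k)) (sym (+-identityʳ p)))) ,
      λ s s<p → good s (subst (s <_) (+-identityʳ p) s<p)
    invariant (suc t) with invariant t
    ... | eq , gd = eq⁺ , gd⁺
      where
      t<p+t : t < p + t
      t<p+t = m<n+m t 1≤p
      eq⁺ : Eq (suc t)
      eq⁺ = begin
        block n (x + suc t)          ≡⟨ cong (block n) (+-suc x t) ⟩
        block n (suc (x + t))        ≡⟨ block-suc n (x + t) (x + (p + t)) eq (det t (p + t) (gd t t<p+t) eq) ⟩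
        block n (suc (x + (p + t)))  ≡⟨ cong (block n) (trans (cong (x +_) (+-suc p t)) (+-suc x (p + t))) ⟨
        block n (x + (p + suc t))    ∎
      gd⁺ : ∀ s → s < p + suc t → Good (block n (x + s))
      gd⁺ s s<p+1+t with m≤n⇒m<n∨m≡n (≤-pred (subst (s <_) (+-suc p t) s<p+1+t))
      ... | inj₁ s<p+t = gd s s<p+t
      -- The block newly reached, at offset `p + t`, is a copy of the good block at offset `t`.
      ... | inj₂ refl  = subst Good eq (gd t t<p+t)

    periodic : ∀ t → W (x + n + t) ≡ W (x + n + (p + t))
    periodic t with invariant t
    ... | eq , gd = begin
      W (x + n + t)         ≡⟨ cong W (swap x n t) ⟩
      W (x + t + n)         ≡⟨ det t (p + t) (gd t (m<n+m t 1≤p)) eq ⟩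
      W (x + (p + t) + n)   ≡⟨ cong W (swap x n (p + t)) ⟨
      W (x + n + (p + t))   ∎
      where
      swap : ∀ a b c → a + b + c ≡ a + c + b
      swap = solve-∀

  -- There are `suc n` factors of length `n`, so two of `f 0`, ..., `f (suc n)` agree; `trapped`
  -- relies on this exact bound. Length 0 is separate because `Sturmian` speaks of positive lengths.
  factors-repeat : ∀ n (f : ℕ → Vec Bool n) → (∀ t → F (f t)) →
    ∃₂ λ s t → s < t × t ≤ suc n × f s ≡ f t
  factors-repeat zero f f∈F with f 0 in eq₀ | f 1 in eq₁
  ... | [] | [] = 0 , 1 , s≤s z≤n , s≤s z≤n , trans eq₀ (sym eq₁)
  factors-repeat (suc n) f f∈F with sturmian (suc n) (s≤s z≤n)
  ... | L , (u , ∈⇔F) , len with repetition L f (λ t → Equivalence.from (∈⇔F (f t)) (f∈F t))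
  ...   | s , t , s<t , t≤len , eq = s , t , s<t , subst (t ≤_) len t≤len , eq

  module Right = RightSpecial F F? total F-suffix F-prefix F-extend

  differ⇒special : ∀ n i j → block n i ≡ block n j → W (i + n) ≢ W (j + n) → Right.Special (block n i)
  differ⇒special n i j eq ne with W (i + n) in eqi | W (j + n) in eqj
  ... | false | false = ⊥-elim (ne refl)
  ... | true  | true  = ⊥-elim (ne refl)
  ... | false | true  = (i , trans (block-∷ʳ n i) (cong (block n i ∷ʳ_) eqi)) ,
                        (j , trans (block-∷ʳ n j) (cong₂ _∷ʳ_ (sym eq) eqj))
  ... | true  | false = (j , trans (block-∷ʳ n j) (cong₂ _∷ʳ_ (sym eq) eqj)) ,
                        (i , trans (block-∷ʳ n i) (cong (block n i ∷ʳ_) eqi))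

  LeftExtendable : ∀ {n} → Vec Bool n → Set
  LeftExtendable v = ∃ λ b → F (b ∷ v)

  leftExtendable? : ∀ {n} (v : Vec Bool n) → Dec (LeftExtendable v)
  leftExtendable? v with F? (false ∷ v) | F? (true ∷ v)
  ... | yes p | _     = yes (false , p)
  ... | no _  | yes q = yes (true , q)
  ... | no ¬p | no ¬q = no λ { (false , p) → ¬p p ; (true , q) → ¬q q }

  later⇒leftExtendable : ∀ {n} i (v : Vec Bool n) → block n (suc i) ≡ v → LeftExtendable v
  later⇒leftExtendable {n} i v eq = W i , i , trans (block-∷ n i) (cong (W i ∷_) eq)

  -- If u recurs but the prefix ua does not, then u = R and later occurrences of u are all followed
  -- by the other letter, so beyond position 0 every block of length |u| determines the next letter.
  prefix-recurs : ∀ n → LeftExtendable (block n 0)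
  prefix-recurs zero    = W 0 , 0 , refl
  prefix-recurs (suc n) with leftExtendable? (block (suc n) 0)
  ... | yes p  = p
  ... | no  ¬p with prefix-recurs n
  ...   | b , i , eq = ⊥-elim absurd
    where
    i-eq : block n (suc i) ≡ block n 0
    i-eq = ∷-injectiveʳ (trans (sym (block-∷ n i)) eq)

    no-return : ∀ j → block n (suc j) ≡ block n 0 → W (suc j + n) ≢ W n
    no-return j eqj e = ¬p (later⇒leftExtendable j _
      (trans (block-∷ʳ n (suc j)) (trans (cong₂ _∷ʳ_ eqj e) (sym (block-∷ʳ n 0)))))

    prefix≡R : block n 0 ≡ Right.R n
    prefix≡R = Right.special⇒≡R _ (differ⇒special n 0 (suc i) (sym i-eq) (λ e → no-return i i-eq (sym e)))

    det : ∀ j k → block n (suc j) ≡ block n (suc k) → W (suc j + n) ≡ W (suc k + n)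
    det j k eqjk with W (suc j + n) ≟ᵇ W (suc k + n)
    ... | yes e = e
    ... | no ne = trans (¬-not (no-return j eqj)) (sym (¬-not (no-return k (trans (sym eqjk) eqj))))
      where
      eqj : block n (suc j) ≡ block n 0
      eqj = trans (Right.special⇒≡R _ (differ⇒special n (suc j) (suc k) eqjk ne)) (sym prefix≡R)

    absurd : ⊥
    absurd with factors-repeat n (λ t → block n (suc t)) (λ t → suc t , refl)
    ... | s , t , s<t , _ , eq with m≤n⇒∃[o]m+o≡n s<t
    -- All offsets here lie beyond position 0, where `det` holds for every block, so `Good` can be
    -- trivial.
    ...   | o , refl = no-deterministic-cycle n (λ _ → ⊤) (suc s) (suc o) (s≤s z≤n)
      (trans eq (cong (λ k → block n (suc k)) (sym (+-suc s o)))) (λ _ _ → tt)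
      (λ a c _ → det (s + a) (s + c))

  -- Only an occurrence at position 0 has no preceding letter, and `prefix-recurs` handles it.
  F-extendˡ : ∀ {n} (v : Vec Bool n) → F v → LeftExtendable v
  F-extendˡ {n} v (zero  , refl) = prefix-recurs n
  F-extendˡ {n} v (suc i , eq)   = later⇒leftExtendable i v eq

-- Reversal, heights and a squeezing inequality.

reverse-∷ʳ : ∀ {n} (v : Vec Bool n) b → reverse (v ∷ʳ b) ≡ b ∷ reverse v
reverse-∷ʳ []      b = refl
reverse-∷ʳ (x ∷ v) b = begin
  reverse (x ∷ (v ∷ʳ b))   ≡⟨ reverse-∷ x (v ∷ʳ b) ⟩
  reverse (v ∷ʳ b) ∷ʳ x    ≡⟨ cong (_∷ʳ x) (reverse-∷ʳ v b) ⟩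
  b ∷ (reverse v ∷ʳ x)     ≡⟨ cong (b ∷_) (reverse-∷ x v) ⟨
  b ∷ reverse (x ∷ v)      ∎

h-∷ʳ : ∀ {n} (v : Vec Bool n) b → h (v ∷ʳ b) ≡ h v + bit b
h-∷ʳ []      b = trans (h-∷ b []) (+-identityʳ (bit b))
h-∷ʳ (x ∷ v) b = begin
  h (x ∷ (v ∷ʳ b))          ≡⟨ h-∷ x (v ∷ʳ b) ⟩
  bit x + h (v ∷ʳ b)        ≡⟨ cong (bit x +_) (h-∷ʳ v b) ⟩
  bit x + (h v + bit b)     ≡⟨ +-assoc (bit x) _ _ ⟨
  bit x + h v + bit b       ≡⟨ cong (_+ bit b) (h-∷ x v) ⟨
  h (x ∷ v) + bit b         ∎

h-reverse : ∀ {n} (v : Vec Bool n) → h (reverse v) ≡ h v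
h-reverse []      = refl
h-reverse (x ∷ v) = begin
  h (reverse (x ∷ v))    ≡⟨ cong h (reverse-∷ x v) ⟩
  h (reverse v ∷ʳ x)     ≡⟨ h-∷ʳ (reverse v) x ⟩
  h (reverse v) + bit x  ≡⟨ cong (_+ bit x) (h-reverse v) ⟩
  h v + bit x            ≡⟨ +-comm (h v) _ ⟩
  bit x + h v            ≡⟨ h-∷ x v ⟨
  h (x ∷ v)              ∎

bit-injective : ∀ x y → bit x ≡ bit y → x ≡ y
bit-injective false false _ = refl
bit-injective true  true  _ = refl

squeeze : ∀ {x x′ y y′} → x ≤ suc x′ → y ≤ suc y′ → 2 + (x′ + y′) ≤ x + y → x ≡ suc x′ × y ≡ suc y′
squeeze {x} {x′} {y} {y′} p q r =
  ≤-antisym p (+-cancelʳ-≤ (suc y′) _ _ (≤-trans (≤-reflexive (lemma x′ y′)) (≤-trans r (+-monoʳ-≤ x q)))) ,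
  ≤-antisym q (+-cancelˡ-≤ (suc x′) _ _ (≤-trans (≤-reflexive (lemma x′ y′)) (≤-trans r (+-monoˡ-≤ y p))))
  where
  lemma : ∀ a b → suc a + suc b ≡ 2 + (a + b)
  lemma = solve-∀

-- Balance and the shape of a shortest violation.

module Heights (W : Word) where
  open Factors W

  ones : ℕ → ℕ → ℕ
  ones i n = h (block n i)

  ones-suc : ∀ i n → ones i (suc n) ≡ bit (W i) + ones (suc i) n
  ones-suc i n = trans (cong h (block-∷ n i)) (h-∷ (W i) (block n (suc i)))

  ones-suc′ : ∀ i n → ones i (suc n) ≡ ones i n + bit (W (i + n))
  ones-suc′ i n = trans (cong h (block-∷ʳ n i)) (h-∷ʳ (block n i) (W (i + n)))

  ones-+ : ∀ i a c → ones i (a + c) ≡ ones i a + ones (i + a) c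
  ones-+ i zero    c = cong (λ k → ones k c) (sym (+-identityʳ i))
  ones-+ i (suc a) c = begin
    ones i (suc (a + c))                             ≡⟨ ones-suc i (a + c) ⟩
    bit (W i) + ones (suc i) (a + c)                 ≡⟨ cong (bit (W i) +_) (ones-+ (suc i) a c) ⟩
    bit (W i) + (ones (suc i) a + ones (suc i + a) c) ≡⟨ +-assoc (bit (W i)) _ _ ⟨
    bit (W i) + ones (suc i) a + ones (suc i + a) c  ≡⟨ cong₂ (λ s k → s + ones k c) (ones-suc i a) (+-suc i a) ⟨
    ones i (suc a) + ones (i + suc a) c              ∎

  -- One inequality suffices, since `i` and `j` may be exchanged.
  Balanced : ℕ → Set
  Balanced n = ∀ i j → ones i n ≤ suc (ones j n)

  -- The factors `1w1` at `i` and `0w0` at `j`, with `w` a palindrome of length `N`.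
  record Imbalance (i j N : ℕ) : Set where
    field
      first₁     : W i ≡ true
      first₀     : W j ≡ false
      last₁      : W (i + suc N) ≡ true
      last₀      : W (j + suc N) ≡ false
      middle     : ∀ k → k < N → W (suc i + k) ≡ W (suc j + k)
      palindrome : ∀ a c → suc (a + c) ≡ N → W (suc i + a) ≡ W (suc i + c)

  minimal-imbalance : ∀ n → (∀ {m} → m < n → Balanced m) →
    ∀ i j → 2 + ones j n ≤ ones i n → ∃ λ N → Imbalance i j N
  minimal-imbalance zero          bal i j ()
  minimal-imbalance (suc zero)    bal i j gap with W (i + 0)
  minimal-imbalance (suc zero)    bal i j ()        | false
  minimal-imbalance (suc zero)    bal i j (s≤s ())  | true
  minimal-imbalance (suc (suc N)) bal i j gap = N , record
    { first₁     = proj₁ first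
    ; first₀     = proj₂ first
    ; last₁      = proj₁ last
    ; last₀      = proj₂ last
    ; middle     = λ k k<N → bit-injective _ _ (middle k k<N)
    ; palindrome = palindrome
    }
    where
    n = suc (suc N)

    -- Both pieces of a cut are shorter than `n`, so each contributes at most 1 to the gap of at
    -- least 2, hence exactly 1.
    split : ∀ a c → suc a + suc c ≡ n →
      ones i (suc a) ≡ suc (ones j (suc a)) × ones (i + suc a) (suc c) ≡ suc (ones (j + suc a) (suc c))
    split a c eq = squeeze
      (bal (subst (suc a <_) eq (m<m+n (suc a) (s≤s z≤n))) i j)
      (bal (subst (suc c <_) eq (m<n+m (suc c) (s≤s z≤n))) (i + suc a) (j + suc a))
      (subst₂ (λ x y → 2 + x ≤ y) (decompose j) (decompose i) gap)
      where
      decompose : ∀ k → ones k n ≡ ones k (suc a) + ones (k + suc a) (suc c)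
      decompose k = trans (cong (ones k) (sym eq)) (ones-+ k (suc a) (suc c))

    ones-1 : ∀ k → ones k 1 ≡ bit (W k)
    ones-1 k = trans (ones-suc k 0) (+-identityʳ _)

    gap-bits : ∀ {x y} → bit x ≡ suc (bit y) → x ≡ true × y ≡ false
    gap-bits {true}  {false} _ = refl , refl
    gap-bits {true}  {true}  ()
    gap-bits {false} {_}     ()

    first : W i ≡ true × W j ≡ false
    first = gap-bits (subst₂ (λ x y → x ≡ suc y) (ones-1 i) (ones-1 j) (proj₁ (split 0 N refl)))

    last : W (i + suc N) ≡ true × W (j + suc N) ≡ false
    last = gap-bits (subst₂ (λ x y → x ≡ suc y) (ones-1 _) (ones-1 _)
      (proj₂ (split N 0 (trans (+-suc (suc N) 0) (cong (λ k → suc (suc k)) (+-identityʳ N))))))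

    -- The gap is 1 at the prefix lengths `k + 1` and `k + 2` alike, so the letters added in between
    -- agree.
    middle : ∀ k → k < N → bit (W (suc i + k)) ≡ bit (W (suc j + k))
    middle k k<N with m≤n⇒∃[o]m+o≡n k<N
    ... | o , refl = +-cancelˡ-≡ (ones i (suc k)) _ _ (begin
      ones i (suc k) + bit (W (suc i + k))        ≡⟨ snoc i ⟨
      ones i (suc (suc k))                        ≡⟨ proj₁ (split (suc k) o (cong suc (+-suc (suc k) o))) ⟩
      suc (ones j (suc (suc k)))                  ≡⟨ cong suc (snoc j) ⟩
      suc (ones j (suc k)) + bit (W (suc j + k))  ≡⟨ cong (_+ bit (W (suc j + k))) (proj₁ (split k (suc o)
            (cong suc (trans (+-suc k (suc o)) (cong suc (+-suc k o)))))) ⟨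
      ones i (suc k) + bit (W (suc j + k))        ∎)
      where
      snoc : ∀ l → ones l (suc (suc k)) ≡ ones l (suc k) + bit (W (suc l + k))
      snoc l = trans (ones-suc′ l (suc k)) (cong (λ m → ones l (suc k) + bit (W m)) (+-suc l k))

    -- By `split`, prefix and suffix at `i` each exceed their counterparts at `j` by 1; balance of
    -- prefix against suffix across `i` and `j` then gives both inequalities.
    prefix≡suffix : ∀ a c → suc a + suc c ≡ n → ones i (suc a) ≡ ones (i + suc c) (suc a)
    prefix≡suffix a c eq = ≤-antisym
      (≤-trans (bal a<n i (j + suc c)) (≤-reflexive (sym (proj₂ (split c a (trans (+-comm (suc c) (suc a)) eq))))))
      (≤-trans (bal a<n (i + suc c) j) (≤-reflexive (sym (proj₁ (split a c eq)))))
      where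
      a<n : suc a < n
      a<n = subst (suc a <_) eq (m<m+n (suc a) (s≤s z≤n))

    -- Comparing `prefix≡suffix` at lengths `a + 1` and `a + 2` isolates two mirrored letters.
    palindrome : ∀ a c → suc (a + c) ≡ N → W (suc i + a) ≡ W (suc i + c)
    palindrome a c refl = bit-injective _ _ (+-cancelʳ-≡ (ones i (suc a)) _ _ (begin
      bit (W (suc i + a)) + ones i (suc a)               ≡⟨ +-comm (bit (W (suc i + a))) _ ⟩
      ones i (suc a) + bit (W (suc i + a))               ≡⟨ cong (λ m → ones i (suc a) + bit (W m)) (+-suc i a) ⟨
      ones i (suc a) + bit (W (i + suc a))               ≡⟨ ones-suc′ i (suc a) ⟨
      ones i (suc (suc a))                               ≡⟨ prefix≡suffix (suc a) c (cong (λ k → suc (suc k)) (+-suc a c)) ⟩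
      ones (i + suc c) (suc (suc a))                     ≡⟨ ones-suc _ (suc a) ⟩
      bit (W (i + suc c)) + ones (suc (i + suc c)) (suc a)
        ≡⟨ cong₂ (λ m l → bit (W m) + ones l (suc a)) (+-suc i c) (sym (+-suc i (suc c))) ⟩
      bit (W (suc i + c)) + ones (i + suc (suc c)) (suc a)
        ≡⟨ cong (bit (W (suc i + c)) +_) (prefix≡suffix a (suc c)
            (cong suc (trans (+-suc a (suc c)) (cong suc (+-suc a c))))) ⟨
      bit (W (suc i + c)) + ones i (suc a)               ∎))

-- Left special factors and the proof of balance.

module TotalHeight (W : Word) (sturmian : Sturmian W) where
  open SturmianWord W sturmian
  open Heights W

  total-reverse : ∀ n → Sum n (λ v → ind (F? (reverse v))) ≡ suc n
  total-reverse n = trans (Sum-reverse n (λ v → ind (F? v))) (total n)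

  extend-reverse : ∀ {n} (v : Vec Bool n) → F (reverse v) → ∃ λ b → F (reverse (v ∷ʳ b))
  extend-reverse v p = let b , q = F-extendˡ (reverse v) p in b , subst F (sym (reverse-∷ʳ v b)) q

  -- In the reversed language the right special words are the reversed left special factors. Its
  -- `extend` is left extension in `W`, which rests on `prefix-recurs`.
  module Left = RightSpecial (λ v → F (reverse v)) (λ v → F? (reverse v)) total-reverse
    (λ b v p → F-prefix b (reverse v) (subst F (reverse-∷ b v) p))
    (λ b v p → F-suffix b (reverse v) (subst F (reverse-∷ʳ v b) p))
    extend-reverse

  ends-with-1 : ∀ n → Sum n (λ v → ind (F? (v ∷ʳ true))) ≡ suc (h (Left.R n))
  ends-with-1 n = begin
    Sum n (λ v → ind (F? (v ∷ʳ true)))             ≡⟨ Sum-reverse n (λ v → ind (F? (v ∷ʳ true))) ⟨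
    Sum n (λ v → ind (F? (reverse v ∷ʳ true)))     ≡⟨ Sum-cong n (λ v → cong (λ u → ind (F? u)) (reverse-∷ true v)) ⟨
    Sum n (λ v → ind (F? (reverse (true ∷ v))))    ≡⟨ Left.starts-with-1 n ⟩
    suc (h (Left.R n))                             ∎

  -- If b w b occurs at i with w a palindrome, then the N + 2 windows of length N + 1
  -- starting at i, …, i + N + 1 all avoid R, so two of them coincide and W is trapped in a cycle.
  trapped : ∀ b N i → W i ≡ b → W (i + suc N) ≡ b →
    (∀ a c → suc (a + c) ≡ N → W (suc i + a) ≡ W (suc i + c)) →
    Right.R (suc N) ≡ not b ∷ block N (suc i) → ⊥
  trapped b N i first last pal R≡ = absurd
    where
    avoids : ∀ t → t ≤ suc N → block (suc N) (i + t) ≢ Right.R (suc N)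
    avoids t t≤ eq = impossible t t≤ (∷-injectiveˡ eq′) (∷-injectiveʳ eq′)
      where
      eq′ : W (i + t) ∷ block N (suc (i + t)) ≡ not b ∷ block N (suc i)
      eq′ = trans (sym (block-∷ N (i + t))) (trans eq R≡)

      b≢not : ∀ {x} → x ≡ b → x ≡ not b → ⊥
      b≢not refl e = not-¬ refl e

      impossible : ∀ t → t ≤ suc N → W (i + t) ≡ not b → block N (suc (i + t)) ≡ block N (suc i) → ⊥
      impossible zero    _         hd tl = b≢not first (trans (cong W (sym (+-identityʳ i))) hd)
      impossible (suc a) (s≤s a≤N) hd tl with m≤n⇒m<n∨m≡n a≤N
      ... | inj₂ refl = b≢not last hd
      ... | inj₁ a<N with m≤n⇒∃[o]m+o≡n a<N
      -- With `w` for `block N (suc i)`: the supposed copy of `w` reaches the final `b` of `b w b`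
      -- at index `c`, whereas the palindrome carries the letter `not b` from index `a` to index
      -- `c`.
      ...   | c , refl = b≢not
        (begin
          W (suc i + c)                    ≡⟨ block-at N _ _ tl c (s≤s (m≤n+m c a)) ⟨
          W (suc (i + suc a) + c)          ≡⟨ cong W (shift i a c) ⟩
          W (i + suc (suc a + c))          ≡⟨ last ⟩
          b                                ∎)
        (trans (sym (pal a c refl)) (trans (cong W (sym (+-suc i a))) hd))
        where
        shift : ∀ i a c → suc (i + suc a) + c ≡ i + suc (suc a + c)
        shift = solve-∀

    det : ∀ x y → block (suc N) x ≢ Right.R (suc N) → block (suc N) x ≡ block (suc N) y →
      W (x + suc N) ≡ W (y + suc N)
    det x y ne eq with W (x + suc N) ≟ᵇ W (y + suc N)
    ... | yes e  = e
    ... | no  ne′ = ⊥-elim (ne (Right.special⇒≡R _ (differ⇒special (suc N) x y eq ne′)))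

    -- Listing `R` first gives `N + 3` factors of length `N + 1`, one more than exist. A collision
    -- with index 0 contradicts `avoids`, so two genuine windows coincide.
    window : ℕ → Vec Bool (suc N)
    window zero    = Right.R (suc N)
    window (suc t) = block (suc N) (i + t)

    window∈F : ∀ t → F (window t)
    window∈F zero    = F-prefix false _ (proj₁ (Right.R-special (suc N)))
    window∈F (suc t) = i + t , refl

    absurd : ⊥
    absurd with factors-repeat (suc N) window window∈F
    ... | zero  , suc t , _         , s≤s t≤ , eq = avoids t t≤ (sym eq)
    ... | suc s , suc t , s≤s s<t   , s≤s t≤ , eq with m≤n⇒∃[o]m+o≡n s<t
    ...   | o , refl = no-deterministic-cycle (suc N) (_≢ Right.R (suc N)) (i + s) (suc o) (s≤s z≤n)
      (trans eq (cong (block (suc N)) (shift i s o)))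
      (λ u u<p → subst (λ k → block (suc N) k ≢ Right.R (suc N)) (sym (+-assoc i s u))
        (avoids (s + u) (≤-trans (+-monoʳ-≤ s (≤-pred u<p)) (≤-trans (n≤1+n _) t≤))))
      (λ u v → det (i + s + u) (i + s + v))
      where
      shift : ∀ i s o → i + (suc s + o) ≡ i + s + suc o
      shift = solve-∀

  -- Since `w` is followed by both letters, it is `R N`, and `R (suc N)` is `0w` or `1w`. In the
  -- first case `1w1` is trapped, in the second `0w0`.
  no-imbalance : ∀ i j N → Imbalance i j N → ⊥
  no-imbalance i j N imb with Right.R-suc N
  ... | b , R≡ = by-letter b R≡
    where
    open Imbalance imb

    same : block N (suc j) ≡ block N (suc i)
    same = block-ext N (suc j) (suc i) (λ k k<N → sym (middle k k<N))

    at : ∀ k b → W (k + suc N) ≡ b → F (block N (suc k) ∷ʳ b)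
    at k b eq = suc k , trans (block-∷ʳ N (suc k)) (cong (block N (suc k) ∷ʳ_) (trans (cong W (sym (+-suc k N))) eq))

    w≡R : block N (suc i) ≡ Right.R N
    w≡R = Right.special⇒≡R _ (subst (λ v → F (v ∷ʳ false)) same (at j false last₀) , at i true last₁)

    palindrome₀ : ∀ a c → suc (a + c) ≡ N → W (suc j + a) ≡ W (suc j + c)
    palindrome₀ a c refl = trans (sym (middle a (s≤s (m≤m+n a c))))
      (trans (palindrome a c refl) (middle c (s≤s (m≤n+m c a))))

    by-letter : ∀ b → Right.R (suc N) ≡ b ∷ Right.R N → ⊥
    by-letter false R≡ = trapped true N i first₁ last₁ palindrome
      (trans R≡ (cong (false ∷_) (sym w≡R)))
    by-letter true R≡ = trapped false N j first₀ last₀ palindrome₀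
      (trans R≡ (cong (true ∷_) (sym (trans same w≡R))))

  balanced : ∀ n → Balanced n
  balanced = <-rec _ λ n bal i j → ≮⇒≥ λ gap →
    let N , imb = minimal-imbalance n bal i j gap in no-imbalance i j N imb

  balanced-factors : ∀ {n} {u v : Vec Bool n} → F u → F v → h u ≤ suc (h v)
  balanced-factors {n} (i , refl) (j , refl) = balanced n i j

  -- The left special factor is `reverse L`, so balance compares `R` with `reverse L`, and reversal
  -- preserves height.
  h-R≡h-L : ∀ n → h (Right.R n) ≡ h (Left.R n)
  h-R≡h-L n = trans (≤-antisym R≤L L≤R) (h-reverse L)
    where
    R = Right.R n
    L = Left.R n
    R-special = Right.R-special n
    left : ∀ b → F (reverse (L ∷ʳ b)) → F (b ∷ reverse L)
    left b = subst F (reverse-∷ʳ L b)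
    R≤L : h R ≤ h (reverse L)
    R≤L = ≤-pred (subst (_≤ suc (h (reverse L))) (trans (h-∷ʳ R true) (+-comm (h R) 1))
      (balanced-factors (proj₂ R-special) (left false (proj₁ (Left.R-special n)))))
    L≤R : h (reverse L) ≤ h R
    L≤R = ≤-pred (subst (suc (h (reverse L)) ≤_) (cong suc (trans (h-∷ʳ R false) (+-identityʳ (h R))))
      (balanced-factors (left true (proj₂ (Left.R-special n))) (proj₁ R-special)))

  -- Recursion for the total height and its parity.

  totalHeight : ℕ → ℕ
  totalHeight n = Sum n (λ v → ind (F? v) * h v)

  -- The height of `R n` enters twice: `R n` is a prefix of two factors, and by `h-R≡h-L` the number
  -- of factors ending in 1 is `suc (h (R n))`.
  totalHeight-suc : ∀ n → totalHeight (suc n) ≡ totalHeight n + 1 + h (Right.R n) * 2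
  totalHeight-suc n = begin
    Sum (suc n) (λ v → φ v * h v)
      ≡⟨ Sum-snoc n (λ v → φ v * h v) ⟩
    Sum n (λ v → φ (v ∷ʳ false) * h (v ∷ʳ false) + φ (v ∷ʳ true) * h (v ∷ʳ true))
      ≡⟨ Sum-cong n pointwise ⟩
    Sum n (λ v → φ v * h v + δ (R n) v * h v + φ (v ∷ʳ true))
      ≡⟨ trans (Sum-+ n (λ v → φ v * h v + δ (R n) v * h v) _)
           (cong (_+ Sum n (λ v → φ (v ∷ʳ true))) (Sum-+ n (λ v → φ v * h v) _)) ⟩
    totalHeight n + Sum n (λ v → δ (R n) v * h v) + Sum n (λ v → φ (v ∷ʳ true))
      ≡⟨ cong₂ (λ x y → totalHeight n + x + y) (Sum-δ n (R n) h)
           (trans (ends-with-1 n) (cong suc (sym (h-R≡h-L n)))) ⟩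
    totalHeight n + h (R n) + suc (h (R n))
      ≡⟨ collect (totalHeight n) (h (R n)) ⟩
    totalHeight n + 1 + h (R n) * 2 ∎
    where
    open Right
    collect : ∀ a b → a + b + suc b ≡ a + 1 + b * 2
    collect = solve-∀
    expand : ∀ x y z → x * (z + 0) + y * (z + 1) ≡ (x + y) * z + y
    expand = solve-∀
    pointwise : ∀ v → φ (v ∷ʳ false) * h (v ∷ʳ false) + φ (v ∷ʳ true) * h (v ∷ʳ true)
      ≡ φ v * h v + δ (R n) v * h v + φ (v ∷ʳ true)
    pointwise v = begin
      φ (v ∷ʳ false) * h (v ∷ʳ false) + φ (v ∷ʳ true) * h (v ∷ʳ true)
        ≡⟨ cong₂ (λ a b → φ (v ∷ʳ false) * a + φ (v ∷ʳ true) * b) (h-∷ʳ v false) (h-∷ʳ v true) ⟩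
      φ (v ∷ʳ false) * (h v + 0) + φ (v ∷ʳ true) * (h v + 1)
        ≡⟨ expand (φ (v ∷ʳ false)) (φ (v ∷ʳ true)) (h v) ⟩
      (φ (v ∷ʳ false) + φ (v ∷ʳ true)) * h v + φ (v ∷ʳ true)
        ≡⟨ cong (λ s → s * h v + φ (v ∷ʳ true)) (trans (φ-split v) (cong (φ v +_) (excess-δ v))) ⟩
      (φ v + δ (R n) v) * h v + φ (v ∷ʳ true)
        ≡⟨ cong (_+ φ (v ∷ʳ true)) (*-distribʳ-+ (h v) (φ v) _) ⟩
      φ v * h v + δ (R n) v * h v + φ (v ∷ʳ true) ∎

  totalHeight-parity : ∀ n → totalHeight n % 2 ≡ n % 2
  totalHeight-parity zero    = cong (_% 2) (*-zeroʳ (ind (F? [])))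
  totalHeight-parity (suc n) = begin
    totalHeight (suc n) % 2                              ≡⟨ cong (_% 2) (totalHeight-suc n) ⟩
    (totalHeight n + 1 + h (Right.R n) * 2) % 2          ≡⟨ [m+kn]%n≡m%n (totalHeight n + 1) (h (Right.R n)) 2 ⟩
    (totalHeight n + 1) % 2                              ≡⟨ %-distribˡ-+ (totalHeight n) 1 2 ⟩
    (totalHeight n % 2 + 1) % 2                          ≡⟨ cong (λ r → (r + 1) % 2) (totalHeight-parity n) ⟩
    (n % 2 + 1) % 2                                      ≡⟨ %-distribˡ-+ n 1 2 ⟨
    (n + 1) % 2                                          ≡⟨ cong (_% 2) (+-comm n 1) ⟩
    suc n % 2                                            ∎

theorem1 : (W : Word) → Sturmian W → (n : ℕ) → 1 ≤ n →
    (L : List (Vec Bool n)) → Enumerates W n L →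
    sum (map h L) % 2 ≡ n % 2
theorem1 W sturmian n _ L L-enum =
  trans (cong (_% 2) (sym (Sum-enumerated n L L-enum h))) (totalHeight-parity n)
  where
  open TotalHeight W sturmian
  open SturmianWord W sturmian
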